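{- Let $M$ be a matroid that is not OTE. Then there exist (i) a non-modular pair $(F,H)$ of flats of $M$, where $H$ is a hyperplane of $M$, and (ii) an extension $N$ of $M$ such that $(\operatorname{cl}_N(F),\operatorname{cl}_N(H))$ is a modular pair in $N$.
   Context: A pair $(X,Y)$ of flats is modular if $\operatorname{rk}(X)+\operatorname{rk}(Y)=\operatorname{rk}(X\cup Y)+\operatorname{rk}(X\cap Y)$. A modular cut of $M$ is a set $\mathcal{M}$ of flats closed under taking flat supersets and such that $F_1\cap F_2\in\mathcal{M}$ whenever $F_1,F_2\in\mathcal{M}$ form a modular pair; it is principal if it equals $\{G\text{ flat}: G\supseteq F\}$ for some flat $F$. $M$ is OTE if every nonempty modular cut is principal. An extension of $M$ on $E$ is a matroid $N$ on $F\supseteq E$ with $N|E=M$. -}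

module Defs where

open import Data.Nat using (ℕ; suc; _+_; _≤_; _<_; _≟_)
open import Data.Bool using (Bool; true; false)
open import Data.Fin using (Fin)
open import Data.Fin.Subset using (Subset; _∈_; _∉_; _⊆_; _∪_; _∩_; ⁅_⁆; ⊤; ∣_∣)
open import Data.Vec using (_++_; replicate; tabulate)
open import Data.Product using (Σ; _×_)
open import Relation.Nullary using (¬_; does)
open import Relation.Binary.PropositionalEquality using (_≡_)

record Matroid (n : ℕ) : Set where
  field
    rk        : Subset n → ℕ
    rk-bound  : ∀ X → rk X ≤ ∣ X ∣
    rk-mono   : ∀ {X Y} → X ⊆ Y → rk X ≤ rk Y
    rk-submod : ∀ X Y → rk (X ∪ Y) + rk (X ∩ Y) ≤ rk X + rk Y

open Matroid public

module _ {n : ℕ} (M : Matroid n) where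

  IsFlat : Subset n → Set
  IsFlat X = ∀ e → e ∉ X → rk M X < rk M (X ∪ ⁅ e ⁆)

  IsHyperplane : Subset n → Set
  IsHyperplane H = IsFlat H × (suc (rk M H) ≡ rk M ⊤)

  ModularPair : Subset n → Subset n → Set
  ModularPair X Y = rk M X + rk M Y ≡ rk M (X ∪ Y) + rk M (X ∩ Y)

  cl : Subset n → Subset n
  cl X = tabulate (λ e → does (rk M (X ∪ ⁅ e ⁆) ≟ rk M X))

  -- A set of subsets of E (finite, so represented by its characteristic function).
  SetOfSets : Set
  SetOfSets = Subset n → Bool

  _∈ₛ_ : Subset n → SetOfSets → Set
  X ∈ₛ 𝓜 = 𝓜 X ≡ true

  IsModularCut : SetOfSets → Set
  IsModularCut 𝓜 =
      (∀ F → F ∈ₛ 𝓜 → IsFlat F)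
    × (∀ F G → F ∈ₛ 𝓜 → IsFlat G → F ⊆ G → G ∈ₛ 𝓜)
    × (∀ F₁ F₂ → F₁ ∈ₛ 𝓜 → F₂ ∈ₛ 𝓜 → ModularPair F₁ F₂ → (F₁ ∩ F₂) ∈ₛ 𝓜)

  Nonempty : SetOfSets → Set
  Nonempty 𝓜 = Σ (Subset n) λ F → F ∈ₛ 𝓜

  IsPrincipal : SetOfSets → Set
  IsPrincipal 𝓜 = Σ (Subset n) λ F → IsFlat F ×
    (∀ G → (G ∈ₛ 𝓜 → IsFlat G × F ⊆ G) × (IsFlat G × F ⊆ G → G ∈ₛ 𝓜))

  OTE : Set
  OTE = ∀ 𝓜 → IsModularCut 𝓜 → Nonempty 𝓜 → IsPrincipal 𝓜

liftSet : ∀ {n} k → Subset n → Subset (n + k)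
liftSet k X = X ++ replicate k false

IsExtension : ∀ {n k} → Matroid n → Matroid (n + k) → Set
IsExtension {n} {k} M N = ∀ (X : Subset n) → rk N (liftSet k X) ≡ rk M X

{-# OPTIONS --safe #-}
module Submission where

-- If M is not OTE, some modular cut 𝓜 contains flats F and H with F ∩ H ∉ 𝓜; call
-- (F , H) a bad pair, and let
--   δ F H = r F + r H − r (F ∪ H) − r (F ∩ H)
-- be its modular defect.  Let k > 0 be the least defect of a bad pair, and among the
-- bad pairs of defect k take (A , H) with r H largest.  For a ∈ A ∖ H and
-- H′ = cl (H ∪ a), maximality forces F = A ∩ H′ ∈ 𝓜, and (F , H) is again a bad pair
-- of defect k.  Maximality also forces F ∪ H to span M; since F ∪ H ⊆ H′, the flat H
-- is a hyperplane.
--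
-- Now add k new elements as freely as possible to all flats of 𝓜 at once:
--   r_N (A ∪ J) = min (r A + ∣ J ∣ , min { r G : A ⊆ G ∈ 𝓜 }).
-- Submodularity could fail only at a bad pair, and there the defect is at least k,
-- which pays for the new elements.  In N the closures of F and H both gain all k new
-- elements, and the rank of their meet goes up by exactly k = δ F H.

open import Defs
open import Data.Nat using (ℕ; zero; suc; _+_; _∸_; _⊓_; _≤_; _<_; _≟_; _≤?_; _<?_)
open import Data.Nat.Properties
open import Data.Nat.Induction using (<-wellFounded)
open import Data.Nat.Tactic.RingSolver using (solve-∀)
open import Data.Bool using (Bool; true; false)
import Data.Bool.Properties as Bool
open import Data.Fin using (Fin; splitAt; _↑ˡ_; _↑ʳ_) renaming (zero to fzero; suc to fsuc)
open import Data.Fin.Properties using (all?; any?; splitAt⁻¹-↑ˡ; splitAt⁻¹-↑ʳ)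
open import Data.Fin.Subset using (Subset; _∈_; _⊆_; _∪_; _∩_; ⁅_⁆; ⊤; ⊥; ∣_∣)
open import Data.Fin.Subset.Properties
open import Data.Vec using ([]; _∷_; _++_; take; drop; lookup; here; there)
open import Data.Vec.Properties
  using (take-zipWith; drop-zipWith; take++drop≡id; zipWith-++; ++-injectiveˡ; ++-injectiveʳ;
         tabulate∘lookup; tabulate-cong; lookup-++ˡ; lookup-++ʳ;
         []=⇒lookup; lookup⇒[]=; lookup-replicate)
open import Data.Product using (Σ; ∃; _×_; _,_; proj₁; proj₂)
open import Data.Sum using (inj₁; inj₂)
open import Function using (_∘_)
open import Induction.WellFounded using (Acc; acc)
open import Relation.Nullary using (¬_; Dec; yes; no; does; contradiction)
open import Relation.Nullary.Decidable
  using (map′; ¬?; _×-dec_; _→-dec_; decidable-stable; dec-true; dec-false)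
open import Relation.Unary using (Decidable)
open import Relation.Binary.PropositionalEquality
  using (_≡_; _≗_; refl; sym; trans; cong; cong₂; subst; subst₂; module ≡-Reasoning)

-- Exhaustive search and minimisation over finite types.

Exhaustible : Set → Set₁
Exhaustible A = {P : A → Set} → Decidable P → Dec (∃ P)

×-exhaustible : ∀ {A B} → Exhaustible A → Exhaustible B → Exhaustible (A × B)
×-exhaustible anyA anyB P? =
  map′ (λ (a , b , p) → (a , b) , p) (λ ((a , b) , p) → a , b , p)
    (anyA λ a → anyB λ b → P? (a , b))

-- Abstract, since `with` would otherwise normalise the search.
abstract
  minimize : ∀ {A} → Exhaustible A → (f : A → ℕ) {P : A → Set} → Decidable P → ∃ P →
    ∃ λ x → P x × (∀ y → P y → f x ≤ f y)
  minimize {A} any f {P} P? (x₀ , p₀) = go x₀ p₀ (<-wellFounded (f x₀))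
    where
    go : ∀ x → P x → Acc _<_ (f x) → ∃ λ z → P z × (∀ y → P y → f z ≤ f y)
    go x p (acc rec) with any (λ y → P? y ×-dec f y <? f x)
    ... | yes (y , q , y<x) = go y q (rec y<x)
    ... | no ¬smaller = x , p , λ y q → ≮⇒≥ λ y<x → ¬smaller (y , q , y<x)

allSubset? : ∀ {n} {P : Subset n → Set} → Decidable P → Dec (∀ X → P X)
allSubset? P? = map′
  (λ ¬∃¬ X → decidable-stable (P? X) λ ¬p → ¬∃¬ (X , ¬p))
  (λ all (X , ¬p) → ¬p (all X))
  (¬? (anySubset? (¬? ∘ P?)))

-- Without function extensionality, a family of subsets can be searched for only
-- up to pointwise equality, so the predicate has to respect it.
anyFamily? : ∀ {n} {P : (Subset n → Bool) → Set} →
  (∀ {f g} → f ≗ g → P f → P g) → Decidable P → Dec (∃ P)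
anyFamily? {zero} {P} resp P? with P? (λ _ → true) | P? (λ _ → false)
... | yes p | _     = yes (_ , p)
... | no _  | yes q = yes (_ , q)
... | no ¬p | no ¬q = no λ (f , r) → refute f (f []) refl r
  where
  refute : ∀ f b → f [] ≡ b → ¬ P f
  refute f true  eq r = ¬p (resp (λ { [] → eq }) r)
  refute f false eq r = ¬q (resp (λ { [] → eq }) r)
anyFamily? {suc n} {P} resp P? = map′
  (λ (f , g , p) → glue f g , p)
  (λ (h , p) → h ∘ (true ∷_) , h ∘ (false ∷_) ,
    resp (λ { (true ∷ _) → refl ; (false ∷ _) → refl }) p)
  (anyFamily? (λ f≗f′ (g , p) → g , resp (glue-cong f≗f′ (λ _ → refl)) p) λ f →
    anyFamily? (λ g≗g′ → resp (glue-cong (λ _ → refl) g≗g′)) λ g → P? (glue f g))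
  where
  glue : (f g : Subset n → Bool) → Subset (suc n) → Bool
  glue f g (true  ∷ X) = f X
  glue f g (false ∷ X) = g X
  glue-cong : ∀ {f f′ g g′} → f ≗ f′ → g ≗ g′ → glue f g ≗ glue f′ g′
  glue-cong f≗ g≗ (true  ∷ X) = f≗ X
  glue-cong f≗ g≗ (false ∷ X) = g≗ X

-- Subsets: lattice facts, sizes, and concatenation of ground sets.

∪-lub : ∀ {n} {X Y Z : Subset n} → X ⊆ Z → Y ⊆ Z → X ∪ Y ⊆ Z
∪-lub {X = X} {Y} X⊆Z Y⊆Z x∈ with x∈p∪q⁻ X Y x∈
... | inj₁ x∈X = X⊆Z x∈X
... | inj₂ x∈Y = Y⊆Z x∈Y

∩-glb : ∀ {n} {X Y Z : Subset n} → Z ⊆ X → Z ⊆ Y → Z ⊆ X ∩ Y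
∩-glb Z⊆X Z⊆Y z∈ = x∈p∩q⁺ (Z⊆X z∈ , Z⊆Y z∈)

∪-mono : ∀ {n} {X Y X′ Y′ : Subset n} → X ⊆ X′ → Y ⊆ Y′ → X ∪ Y ⊆ X′ ∪ Y′
∪-mono {X′ = X′} {Y′} X⊆ Y⊆ =
  ∪-lub (λ x → p⊆p∪q Y′ (X⊆ x)) (λ y → q⊆p∪q X′ Y′ (Y⊆ y))

∩-mono : ∀ {n} {X Y X′ Y′ : Subset n} → X ⊆ X′ → Y ⊆ Y′ → X ∩ Y ⊆ X′ ∩ Y′
∩-mono {X = X} {Y} X⊆ Y⊆ = ∩-glb (X⊆ ∘ p∩q⊆p X Y) (Y⊆ ∘ p∩q⊆q X Y)

⁅⁆⊆ : ∀ {n} {e : Fin n} {X : Subset n} → e ∈ X → ⁅ e ⁆ ⊆ X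
⁅⁆⊆ {e = e} {X} e∈X x∈ = subst (_∈ X) (sym (x∈⁅y⁆⇒x≡y e x∈)) e∈X

e∈X∪⁅e⁆ : ∀ {n} (X : Subset n) (e : Fin n) → e ∈ X ∪ ⁅ e ⁆
e∈X∪⁅e⁆ X e = q⊆p∪q X ⁅ e ⁆ (x∈⁅x⁆ e)

∪-absorb : ∀ {n} {e : Fin n} {X : Subset n} → e ∈ X → X ∪ ⁅ e ⁆ ≡ X
∪-absorb {X = X} e∈X = ⊆-antisym (∪-lub (λ x → x) (⁅⁆⊆ e∈X)) (p⊆p∪q _)

∣p∪q∣+∣p∩q∣≡∣p∣+∣q∣ : ∀ {n} (p q : Subset n) → ∣ p ∪ q ∣ + ∣ p ∩ q ∣ ≡ ∣ p ∣ + ∣ q ∣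
∣p∪q∣+∣p∩q∣≡∣p∣+∣q∣ [] [] = refl
∣p∪q∣+∣p∩q∣≡∣p∣+∣q∣ (false ∷ p) (false ∷ q) = ∣p∪q∣+∣p∩q∣≡∣p∣+∣q∣ p q
∣p∪q∣+∣p∩q∣≡∣p∣+∣q∣ (false ∷ p) (true ∷ q) =
  trans (cong suc (∣p∪q∣+∣p∩q∣≡∣p∣+∣q∣ p q)) (sym (+-suc _ _))
∣p∪q∣+∣p∩q∣≡∣p∣+∣q∣ (true ∷ p) (false ∷ q) = cong suc (∣p∪q∣+∣p∩q∣≡∣p∣+∣q∣ p q)
∣p∪q∣+∣p∩q∣≡∣p∣+∣q∣ (true ∷ p) (true ∷ q) =
  cong suc (trans (+-suc _ _) (trans (cong suc (∣p∪q∣+∣p∩q∣≡∣p∣+∣q∣ p q)) (sym (+-suc _ _))))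

∣p++q∣≡∣p∣+∣q∣ : ∀ {m k} (p : Subset m) (q : Subset k) → ∣ p ++ q ∣ ≡ ∣ p ∣ + ∣ q ∣
∣p++q∣≡∣p∣+∣q∣ []          q = refl
∣p++q∣≡∣p∣+∣q∣ (true ∷ p)  q = cong suc (∣p++q∣≡∣p∣+∣q∣ p q)
∣p++q∣≡∣p∣+∣q∣ (false ∷ p) q = ∣p++q∣≡∣p∣+∣q∣ p q

take-⊆ : ∀ m {k} {X Y : Subset (m + k)} → X ⊆ Y → take m X ⊆ take m Y
take-⊆ (suc m) {X = _ ∷ _} {_ ∷ _} X⊆Y here with X⊆Y here
... | here = here
take-⊆ (suc m) {X = _ ∷ _} {_ ∷ _} X⊆Y (there x∈) = there (take-⊆ m (drop-∷-⊆ X⊆Y) x∈)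

drop-⊆ : ∀ m {k} {X Y : Subset (m + k)} → X ⊆ Y → drop m X ⊆ drop m Y
drop-⊆ zero X⊆Y = X⊆Y
drop-⊆ (suc m) {X = _ ∷ _} {_ ∷ _} X⊆Y = drop-⊆ m (drop-∷-⊆ X⊆Y)

⊥++⊥ : ∀ m k → ⊥ {m + k} ≡ ⊥ {m} ++ ⊥ {k}
⊥++⊥ zero    k = refl
⊥++⊥ (suc m) k = cong (false ∷_) (⊥++⊥ m k)

⁅↑ˡ⁆ : ∀ {m} k (i : Fin m) → ⁅ i ↑ˡ k ⁆ ≡ ⁅ i ⁆ ++ ⊥
⁅↑ˡ⁆ {suc m} k fzero = cong (true ∷_) (⊥++⊥ m k)
⁅↑ˡ⁆ k (fsuc i) = cong (false ∷_) (⁅↑ˡ⁆ k i)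

⁅↑ʳ⁆ : ∀ m {k} (j : Fin k) → ⁅ m ↑ʳ j ⁆ ≡ ⊥ {m} ++ ⁅ j ⁆
⁅↑ʳ⁆ zero    j = refl
⁅↑ʳ⁆ (suc m) j = cong (false ∷_) (⁅↑ʳ⁆ m j)

-- Rank, flat hulls and the modular defect.

module _ {n : ℕ} (M : Matroid n) where

  private
    r : Subset n → ℕ
    r = rk M

  rk-submod-⊆ : ∀ {X Y U I} → U ⊆ X ∪ Y → I ⊆ X ∩ Y → r U + r I ≤ r X + r Y
  rk-submod-⊆ {X} {Y} U⊆ I⊆ =
    ≤-trans (+-mono-≤ (rk-mono M U⊆) (rk-mono M I⊆)) (rk-submod M X Y)

  rk-∪⁅⁆ : ∀ X e → r (X ∪ ⁅ e ⁆) ≤ suc (r X)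
  rk-∪⁅⁆ X e = begin
    r (X ∪ ⁅ e ⁆)                   ≤⟨ m≤m+n _ _ ⟩
    r (X ∪ ⁅ e ⁆) + r (X ∩ ⁅ e ⁆)   ≤⟨ rk-submod M X ⁅ e ⁆ ⟩
    r X + r ⁅ e ⁆                   ≤⟨ +-monoʳ-≤ (r X) (rk-bound M ⁅ e ⁆) ⟩
    r X + ∣ ⁅ e ⁆ ∣                 ≡⟨ cong (r X +_) (∣⁅x⁆∣≡1 e) ⟩
    r X + 1                         ≡⟨ +-comm (r X) 1 ⟩
    suc (r X)                       ∎
    where open ≤-Reasoning

  isFlat? : ∀ X → Dec (IsFlat M X)
  isFlat? X = all? λ e → ¬? (e ∈? X) →-dec r X <? r (X ∪ ⁅ e ⁆)

  -- A largest superset of X of the same rank is a flat.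
  flatHull : ∀ X → ∃ λ G → IsFlat M G × X ⊆ G × r G ≡ r X
  flatHull X with minimize anySubset? (λ Y → n ∸ ∣ Y ∣)
    (λ Y → (X ⊆? Y) ×-dec (r Y ≟ r X)) (X , (λ x → x) , refl)
  ... | G , (X⊆G , rG≡rX) , largest = G , flat , X⊆G , rG≡rX
    where
    flat : IsFlat M G
    flat e e∉G = ≤∧≢⇒< (rk-mono M (p⊆p∪q ⁅ e ⁆)) λ eq →
      let G⊂ = p⊂q⇒∣p∣<∣q∣ (p⊆p∪q ⁅ e ⁆ , e , e∈X∪⁅e⁆ G e , e∉G)
          bigger = largest (G ∪ ⁅ e ⁆) (⊆-trans X⊆G (p⊆p∪q ⁅ e ⁆) , trans (sym eq) rG≡rX)
      in <⇒≱ (∸-monoʳ-< G⊂ (∣p∣≤n (G ∪ ⁅ e ⁆))) bigger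

  δ : Subset n → Subset n → ℕ
  δ X Y = (r X + r Y) ∸ (r (X ∪ Y) + r (X ∩ Y))

  δ-spec : ∀ X Y → δ X Y + (r (X ∪ Y) + r (X ∩ Y)) ≡ r X + r Y
  δ-spec X Y = m∸n+n≡m (rk-submod M X Y)

  -- Both subtracted terms are moved across the inequality, so a comparison of defects can be proved
  -- without truncated subtraction.
  δ-≤ : ∀ {C D A B} →
    r C + r D + (r (A ∪ B) + r (A ∩ B)) ≤ r A + r B + (r (C ∪ D) + r (C ∩ D)) →
    δ C D ≤ δ A B
  δ-≤ {C} {D} {A} {B} le = +-cancelʳ-≤ (q + p) _ _ (begin
    δ C D + (q + p)      ≡⟨ shuffle (δ C D) q p ⟩
    (δ C D + q) + p      ≡⟨ cong (_+ p) (δ-spec C D) ⟩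
    r C + r D + p        ≤⟨ le ⟩
    r A + r B + q        ≡⟨ cong (_+ q) (δ-spec A B) ⟨
    δ A B + p + q        ≡⟨ shuffle′ (δ A B) q p ⟩
    δ A B + (q + p)      ∎)
    where
    open ≤-Reasoning
    p q : ℕ
    p = r (A ∪ B) + r (A ∩ B)
    q = r (C ∪ D) + r (C ∩ D)
    shuffle : ∀ x q p → x + (q + p) ≡ (x + q) + p
    shuffle = solve-∀
    shuffle′ : ∀ x q p → x + p + q ≡ x + (q + p)
    shuffle′ = solve-∀

  -- Modular cuts and bad pairs.

  BadPair : SetOfSets M → Subset n × Subset n → Set
  BadPair 𝓜 (A , B) = 𝓜 A ≡ true × 𝓜 B ≡ true × 𝓜 (A ∩ B) ≡ false

  badPair? : ∀ 𝓜 → Decidable (BadPair 𝓜)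
  badPair? 𝓜 (A , B) =
    (𝓜 A Bool.≟ true) ×-dec (𝓜 B Bool.≟ true) ×-dec (𝓜 (A ∩ B) Bool.≟ false)

  isModularCut? : Decidable (IsModularCut M)
  isModularCut? 𝓜 =
    (allSubset? λ F → (𝓜 F Bool.≟ true) →-dec isFlat? F) ×-dec
    (allSubset? λ F → allSubset? λ G →
      (𝓜 F Bool.≟ true) →-dec (isFlat? G →-dec ((F ⊆? G) →-dec (𝓜 G Bool.≟ true)))) ×-dec
    (allSubset? λ F → allSubset? λ G →
      (𝓜 F Bool.≟ true) →-dec ((𝓜 G Bool.≟ true) →-dec
        ((r F + r G ≟ r (F ∪ G) + r (F ∩ G)) →-dec (𝓜 (F ∩ G) Bool.≟ true))))

  HasBadPair : SetOfSets M → Set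
  HasBadPair 𝓜 = IsModularCut M 𝓜 × ∃ (BadPair 𝓜)

  -- Every clause consults the family only through its values, so pointwise equality is enough;
  -- `anyFamily?` asks for exactly this.
  HasBadPair-resp : ∀ {𝓜 𝓝} → 𝓜 ≗ 𝓝 → HasBadPair 𝓜 → HasBadPair 𝓝
  HasBadPair-resp eq ((flat , up , meet) , (A , B) , a , b , ab) =
    ( (λ F → flat F ∘ back)
    , (λ F G f g F⊆G → to (up F G (back f) g F⊆G))
    , (λ F G f g mod → to (meet F G (back f) (back g) mod)))
    , (A , B) , to a , to b , to ab
    where
    back : ∀ {X b} → _ ≡ b → _ ≡ b
    back {X} = trans (eq X)
    to : ∀ {X b} → _ ≡ b → _ ≡ b
    to {X} = trans (sym (eq X))

  -- A member `F` of least size lies below every member `G`: without bad pairs `F ∩ G` is again a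
  -- member, and it would be smaller than `F` if `F` were not inside `G`.
  closed⇒principal : ∀ 𝓜 → IsModularCut M 𝓜 → Nonempty M 𝓜 →
    ¬ ∃ (BadPair 𝓜) → IsPrincipal M 𝓜
  closed⇒principal 𝓜 (flat , up , _) nonempty noBad
    with minimize anySubset? ∣_∣ (λ X → 𝓜 X Bool.≟ true) nonempty
  ... | F , F∈ , smallest = F , flat F F∈ , λ G →
    (λ G∈ → flat G G∈ , F⊆ G G∈) , λ (flatG , F⊆G) → up F G F∈ flatG F⊆G
    where
    F⊆ : ∀ G → 𝓜 G ≡ true → F ⊆ G
    F⊆ G G∈ {x} x∈F with x ∈? G | 𝓜 (F ∩ G) in eq
    ... | yes x∈G | _     = x∈G
    ... | no _    | false = contradiction ((F , G) , F∈ , G∈ , eq) noBad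
    ... | no x∉G  | true  = contradiction (smallest (F ∩ G) eq)
      (<⇒≱ (p⊂q⇒∣p∣<∣q∣ (p∩q⊆p F G , x , x∈F , x∉G ∘ p∩q⊆q F G)))

  -- A negated universal yields a witness constructively because the families of subsets can be
  -- searched. If the search found nothing, `closed⇒principal` would make `M` OTE.
  ¬OTE⇒badPair : ¬ OTE M → ∃ HasBadPair
  ¬OTE⇒badPair ¬ote with anyFamily? HasBadPair-resp
    (λ 𝓜 → isModularCut? 𝓜 ×-dec ×-exhaustible anySubset? anySubset? (badPair? 𝓜))
  ... | yes found = found
  ... | no none = contradiction
    (λ 𝓜 cut ne → closed⇒principal 𝓜 cut ne λ bad → none (𝓜 , cut , bad)) ¬ote

  -- A bad pair of least defect whose second flat is a hyperplane.

  module _ (𝓜 : SetOfSets M) (cut : IsModularCut M 𝓜) where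

    private
      flat : ∀ {F} → 𝓜 F ≡ true → IsFlat M F
      flat = proj₁ cut _

      up : ∀ {F G} → 𝓜 F ≡ true → IsFlat M G → F ⊆ G → 𝓜 G ≡ true
      up = proj₁ (proj₂ cut) _ _

    -- The flat hull of `X` is a flat above `F`, so upward closure puts it in `𝓜`.
    cutHull : ∀ {F X} → 𝓜 F ≡ true → F ⊆ X → ∃ λ G → 𝓜 G ≡ true × X ⊆ G × r G ≡ r X
    cutHull {X = X} F∈ F⊆X with flatHull X
    ... | G , flatG , X⊆G , rG≡rX = G , up F∈ flatG (⊆-trans F⊆X X⊆G) , X⊆G , rG≡rX

    badPair⇒¬modular : ∀ {A B} → BadPair 𝓜 (A , B) → ¬ ModularPair M A B
    badPair⇒¬modular (A∈ , B∈ , A∩B∉) mod =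
      contradiction (trans (sym (proj₂ (proj₂ cut) _ _ A∈ B∈ mod)) A∩B∉) λ ()

    badPair⇒⊈ : ∀ {A B} → BadPair 𝓜 (A , B) → ¬ A ⊆ B
    badPair⇒⊈ {A} {B} (A∈ , _ , A∩B∉) A⊆B = contradiction
      (trans (sym A∈) (trans (cong 𝓜 (⊆-antisym (∩-glb (λ x → x) A⊆B) (p∩q⊆p A B))) A∩B∉)) λ ()

    -- `d` will be the least defect, so the bound `≤ d` singles out the bad pairs that attain it.
    module _ (d : ℕ) {B : Subset n} (B∈ : 𝓜 B ≡ true)
      (largest : ∀ C D → BadPair 𝓜 (C , D) → δ C D ≤ d → r D ≤ r B) where

      -- A point outside cl (C ∪ B) can be added to B without changing C ∩ B or
      -- increasing δ.
      spanning : ∀ {C} → BadPair 𝓜 (C , B) → δ C B ≤ d → r (C ∪ B) ≡ r ⊤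
      spanning {C} (C∈ , _ , C∩B∉) δ≤d with flatHull (C ∪ B)
      ... | K , flatK , CB⊆K , rK≡ with any? (λ e → ¬? (e ∈? K))
      ... | no full = ≤-antisym (rk-mono M ⊆⊤) (subst (r ⊤ ≤_) rK≡ (rk-mono M ⊤⊆K))
        where
        ⊤⊆K : ⊤ ⊆ K
        ⊤⊆K {x} _ = decidable-stable (x ∈? K) λ x∉K → full (x , x∉K)
      ... | yes (p , p∉K) with cutHull B∈ (p⊆p∪q {p = B} ⁅ p ⁆)
      ... | B′ , B′∈ , Bp⊆B′ , rB′≡ = contradiction (largest C B′ bad′ (≤-trans δ′≤δ δ≤d)) (<⇒≱ rB<rB′)
        where
        B⊆B′ : B ⊆ B′
        B⊆B′ = Bp⊆B′ ∘ p⊆p∪q ⁅ p ⁆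
        B⊆K : B ⊆ K
        B⊆K = CB⊆K ∘ q⊆p∪q C B
        p∈B′ : p ∈ B′
        p∈B′ = Bp⊆B′ (e∈X∪⁅e⁆ B p)
        rB<rB′ : r B < r B′
        rB<rB′ = subst (r B <_) (sym rB′≡) (flat B∈ p (p∉K ∘ B⊆K))
        rB′≤ : r B′ ≤ suc (r B)
        rB′≤ = subst (_≤ suc (r B)) (sym rB′≡) (rk-∪⁅⁆ B p)

        -- If `x` in `C ∩ B′` were outside `B`, then `B ∪ ⁅ x ⁆` would have at least the rank of
        -- `B′` while lying in both `K` and `B′`. Submodularity of `K` and `B′` would then make `p`
        -- add no rank to `K`, although `K` is a flat that misses `p`.
        C∩B′⊆B : C ∩ B′ ⊆ B
        C∩B′⊆B {x} x∈ = decidable-stable (x ∈? B) λ x∉B → <⇒≱ (flatK p p∉K)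
          (+-cancelʳ-≤ (r B′) _ _ (begin
            r (K ∪ ⁅ p ⁆) + r B′           ≤⟨ +-monoʳ-≤ _ (≤-trans rB′≤ (flat B∈ x x∉B)) ⟩
            r (K ∪ ⁅ p ⁆) + r (B ∪ ⁅ x ⁆)  ≤⟨ rk-submod-⊆
              (∪-mono (λ y → y) (⁅⁆⊆ p∈B′))
              (∩-glb (∪-lub B⊆K (⁅⁆⊆ (CB⊆K (p⊆p∪q B (p∩q⊆p C B′ x∈)))))
                     (∪-lub B⊆B′ (⁅⁆⊆ (p∩q⊆q C B′ x∈)))) ⟩
            r K + r B′                     ∎))
          where open ≤-Reasoning

        C∩B≡ : C ∩ B ≡ C ∩ B′
        C∩B≡ = ⊆-antisym (∩-mono (λ y → y) B⊆B′) (∩-glb (p∩q⊆p C B′) C∩B′⊆B)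

        bad′ : BadPair 𝓜 (C , B′)
        bad′ = C∈ , B′∈ , subst (λ X → 𝓜 X ≡ false) C∩B≡ C∩B∉

        r∪< : r (C ∪ B) < r (C ∪ B′)
        r∪< = subst (_< r (C ∪ B′)) rK≡ (≤-trans (flatK p p∉K) (+-cancelʳ-≤ (r K) _ _ (begin
          r (K ∪ ⁅ p ⁆) + r K        ≡⟨ cong (r (K ∪ ⁅ p ⁆) +_) rK≡ ⟩
          r (K ∪ ⁅ p ⁆) + r (C ∪ B)  ≤⟨ rk-submod-⊆
            (∪-mono (λ y → y) (⁅⁆⊆ (q⊆p∪q C B′ p∈B′)))
            (∩-glb CB⊆K (∪-mono (λ y → y) B⊆B′)) ⟩
          r K + r (C ∪ B′)           ≡⟨ +-comm (r K) _ ⟩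
          r (C ∪ B′) + r K           ∎)))
          where open ≤-Reasoning

        -- From `B` to `B′` the rank grows by at most one, the rank of the union with `C` by at
        -- least one, and the meet with `C` is unchanged.
        δ′≤δ : δ C B′ ≤ δ C B
        δ′≤δ = δ-≤ (subst₂ _≤_ (arrange _ _ (r C) _) (arrange _ _ (r C) _)
          (+-mono-≤ (≤-trans (+-monoˡ-≤ _ rB′≤) (subst (_≤ r B + r (C ∪ B′)) (+-suc (r B) _) (+-monoʳ-≤ (r B) r∪<)))
                    (+-monoʳ-≤ (r C) (≤-reflexive (cong r C∩B≡)))))
          where
          arrange : ∀ b u c i → (b + u) + (c + i) ≡ c + b + (u + i)
          arrange = solve-∀

      maximal⇒hyperplane : ∀ {A} → BadPair 𝓜 (A , B) → δ A B ≤ d →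
        ∃ λ C → BadPair 𝓜 (C , B) × δ C B ≤ d × IsHyperplane M B
      maximal⇒hyperplane {A} bad@(A∈ , _ , A∩B∉) δ≤d with any? (λ e → (e ∈? A) ×-dec ¬? (e ∈? B))
      ... | no none = contradiction
        (λ {x} x∈A → decidable-stable (x ∈? B) λ x∉B → none (x , x∈A , x∉B)) (badPair⇒⊈ bad)
      ... | yes (a , a∈A , a∉B) with cutHull B∈ (p⊆p∪q {p = B} ⁅ a ⁆)
      ... | B′ , B′∈ , Ba⊆B′ , rB′≡ = C , badC , δC≤d , flat B∈ ,
            ≤-antisym (≤-trans rB<rB′ (rk-mono M ⊆⊤)) (begin
              r ⊤          ≡⟨ spanning badC δC≤d ⟨
              r (C ∪ B)    ≤⟨ rk-mono M (∪-lub (p∩q⊆q A B′) B⊆B′) ⟩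
              r B′         ≡⟨ rB′≡ ⟩
              r (B ∪ ⁅ a ⁆) ≤⟨ rk-∪⁅⁆ B a ⟩
              suc (r B)    ∎)
        where
        open ≤-Reasoning
        C : Subset n
        C = A ∩ B′
        B⊆B′ : B ⊆ B′
        B⊆B′ = Ba⊆B′ ∘ p⊆p∪q ⁅ a ⁆
        a∈B′ : a ∈ B′
        a∈B′ = Ba⊆B′ (e∈X∪⁅e⁆ B a)
        rB<rB′ : r B < r B′
        rB<rB′ = subst (r B <_) (sym rB′≡) (flat B∈ a a∉B)

        arrange : ∀ x y z w → (x + y) + (z + w) ≡ x + z + (y + w)
        arrange = solve-∀
        arrange′ : ∀ b i a u → (b + i) + (a + u) ≡ a + b + (u + i)
        arrange′ = solve-∀

        -- Since `a` lies in `A ∩ B′`, passing from `B` to `B′` raises the rank of the meet with `A`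
        -- at least as much as the rank of the second flat itself; the union does not lose rank.
        δ′≤δ : δ A B′ ≤ δ A B
        δ′≤δ = δ-≤ (subst₂ _≤_ (arrange′ _ _ (r A) _) (arrange′ _ _ (r A) _)
          (+-mono-≤ (begin
             r B′ + r (A ∩ B)           ≡⟨ cong (_+ r (A ∩ B)) rB′≡ ⟩
             r (B ∪ ⁅ a ⁆) + r (A ∩ B)  ≤⟨ rk-submod-⊆
               (∪-mono (λ y → y) (⁅⁆⊆ (x∈p∩q⁺ (a∈A , a∈B′))))
               (∩-glb (p∩q⊆q A B) (∩-mono (λ y → y) B⊆B′)) ⟩
             r B + r (A ∩ B′)           ∎)
           (+-monoʳ-≤ (r A) (rk-mono M (∪-mono (λ y → y) B⊆B′)))))

        -- Otherwise `(A , B′)` would itself be bad with defect at most `d`, while `r B < r B′`.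
        C∈ : 𝓜 C ≡ true
        C∈ with 𝓜 C in eq
        ... | true  = refl
        ... | false = contradiction (largest A B′ (A∈ , B′∈ , eq) (≤-trans δ′≤δ δ≤d)) (<⇒≱ rB<rB′)

        A∩B≡ : A ∩ B ≡ C ∩ B
        A∩B≡ = ⊆-antisym (∩-glb (∩-mono (λ y → y) B⊆B′) (p∩q⊆q A B))
                         (∩-mono (p∩q⊆p A B′) (λ y → y))

        badC : BadPair 𝓜 (C , B)
        badC = C∈ , B∈ , subst (λ X → 𝓜 X ≡ false) A∩B≡ A∩B∉

        -- From `C` to `A` the rank grows at least as much as from `C ∪ B` to `A ∪ B`, and both have
        -- the same meet with `B`.
        δC≤d : δ C B ≤ d
        δC≤d = ≤-trans (δ-≤ (subst₂ _≤_ (arrange (r C) _ (r B) (r (A ∩ B))) (arrange (r A) _ (r B) (r (C ∩ B)))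
          (+-mono-≤ (begin
             r C + r (A ∪ B)  ≡⟨ +-comm (r C) _ ⟩
             r (A ∪ B) + r C  ≤⟨ rk-submod-⊆
               (∪-mono (λ y → y) (q⊆p∪q C B))
               (∩-glb (p∩q⊆p A B′) (p⊆p∪q B)) ⟩
             r A + r (C ∪ B)  ∎)
           (+-monoʳ-≤ (r B) (≤-reflexive (cong r A∩B≡)))))) δ≤d

    badPair⇒hyperplane : ∃ (BadPair 𝓜) → ∃ λ F → ∃ λ H →
      BadPair 𝓜 (F , H) × IsHyperplane M H × (∀ C D → BadPair 𝓜 (C , D) → δ F H ≤ δ C D)
    badPair⇒hyperplane someBad
      with minimize (×-exhaustible anySubset? anySubset?) (λ (C , D) → δ C D) (badPair? 𝓜) someBad
    ... | (A₀ , B₀) , bad₀ , δ₀≤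
      -- As `r D ≤ r ⊤`, minimising this difference maximises `r D`.
      with minimize (×-exhaustible anySubset? anySubset?) (λ (C , D) → r ⊤ ∸ r D)
             (λ (C , D) → badPair? 𝓜 (C , D) ×-dec δ C D ≤? δ A₀ B₀) (_ , bad₀ , ≤-refl)
    ... | (A , B) , (bad , δ≤) , largest
      with maximal⇒hyperplane (δ A₀ B₀) (proj₁ (proj₂ bad))
             (λ C D badCD δCD≤ → ∸-cancelʳ-≤ (rk-mono M ⊆⊤) (largest (C , D) (badCD , δCD≤))) bad δ≤
    ... | C , badC , δC≤ , hyper =
      C , B , badC , hyper , λ X Y badXY → ≤-trans δC≤ (δ₀≤ (X , Y) badXY)

    -- The extension by `k` elements placed freely on all members of the cut.

    module FreeExtension (nonempty : Nonempty M 𝓜) (k : ℕ)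
      (k≤δ : ∀ C D → BadPair 𝓜 (C , D) → k ≤ δ C D) where

      minFlat : ∀ X → ∃ λ G → (𝓜 G ≡ true × X ⊆ G) × (∀ G′ → 𝓜 G′ ≡ true × X ⊆ G′ → r G ≤ r G′)
      minFlat X = minimize anySubset? r (λ G → (𝓜 G Bool.≟ true) ×-dec (X ⊆? G))
        -- The search has a starting point: the whole ground set is a member, since the cut is
        -- nonempty.
        (let G , G∈ , ⊤⊆G , _ = cutHull (proj₂ nonempty) ⊆⊤ in G , G∈ , λ _ → ⊤⊆G ∈⊤)

      minRk : Subset n → ℕ
      minRk X = r (proj₁ (minFlat X))

      minRk-≤ : ∀ {X G} → 𝓜 G ≡ true → X ⊆ G → minRk X ≤ r G
      minRk-≤ {X} G∈ X⊆G = proj₂ (proj₂ (minFlat X)) _ (G∈ , X⊆G)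

      minRk-mono : ∀ {X Y} → X ⊆ Y → minRk X ≤ minRk Y
      minRk-mono {Y = Y} X⊆Y with minFlat Y
      ... | G , (G∈ , Y⊆G) , _ = minRk-≤ G∈ (⊆-trans X⊆Y Y⊆G)

      rk≤minRk : ∀ X → r X ≤ minRk X
      rk≤minRk X with minFlat X
      ... | _ , (_ , X⊆G) , _ = rk-mono M X⊆G

      minRk≤rk : ∀ {F X} → 𝓜 F ≡ true → F ⊆ X → minRk X ≤ r X
      minRk≤rk F∈ F⊆X with cutHull F∈ F⊆X
      ... | G , G∈ , X⊆G , rG≡rX = ≤-trans (minRk-≤ G∈ X⊆G) (≤-reflexive rG≡rX)

      minRk-inCut : ∀ {F X} → 𝓜 F ≡ true → F ⊆ X → minRk X ≡ r X
      minRk-inCut F∈ F⊆X = ≤-antisym (minRk≤rk F∈ F⊆X) (rk≤minRk _)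

      -- When `∣ J ∣` is 1 this is the rank in the single-element extension given by the cut: `r A`
      -- if the closure of `A` is a member, and `r A + 1` otherwise.
      rkJoin : Subset n → Subset k → ℕ
      rkJoin A J = (r A + ∣ J ∣) ⊓ minRk A

      rkJoin-mono : ∀ {A B J K} → A ⊆ B → J ⊆ K → rkJoin A J ≤ rkJoin B K
      rkJoin-mono A⊆B J⊆K =
        ⊓-mono-≤ (+-mono-≤ (rk-mono M A⊆B) (p⊆q⇒∣p∣≤∣q∣ J⊆K)) (minRk-mono A⊆B)

      -- Above a member of the cut the second term of the minimum is already `r A`, so new elements
      -- add no rank.
      rkJoin-inCut : ∀ {F A} J → 𝓜 F ≡ true → F ⊆ A → rkJoin A J ≡ r A
      rkJoin-inCut {A = A} J F∈ F⊆A =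
        trans (m≥n⇒m⊓n≡n (≤-trans (minRk≤rk F∈ F⊆A) (m≤m+n (r A) ∣ J ∣))) (minRk-inCut F∈ F⊆A)

      rkJoin-⊥ : ∀ A → rkJoin A ⊥ ≡ r A
      rkJoin-⊥ A = trans (cong (_⊓ minRk A) (trans (cong (r A +_) (∣⊥∣≡0 k)) (+-identityʳ (r A))))
        (m≤n⇒m⊓n≡m (rk≤minRk A))

      private
        -- Enlarge `B` to a cheapest member `G`. The union `A ∪ G` contains a member, so new
        -- elements cost nothing there; the meet uses the free term, where `∣ J ∩ K ∣` is at most
        -- `∣ J ∣`. Submodularity for `A` and `G` does the rest.
        rkJoin-submod-mixed : ∀ A B (J K : Subset k) →
          rkJoin (A ∪ B) (J ∪ K) + rkJoin (A ∩ B) (J ∩ K) ≤ (r A + ∣ J ∣) + minRk B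
        rkJoin-submod-mixed A B J K with minFlat B
        ... | G , (G∈ , B⊆G) , _ = begin
          rkJoin (A ∪ B) (J ∪ K) + rkJoin (A ∩ B) (J ∩ K)
            ≤⟨ +-mono-≤ (m⊓n≤n (r (A ∪ B) + ∣ J ∪ K ∣) _) (m⊓n≤m _ _) ⟩
          minRk (A ∪ B) + (r (A ∩ B) + ∣ J ∩ K ∣)
            ≤⟨ +-mono-≤
                 (≤-trans (minRk-mono (∪-mono (λ x → x) B⊆G)) (minRk≤rk G∈ (q⊆p∪q A G)))
                 (+-mono-≤ (rk-mono M (∩-mono (λ x → x) B⊆G)) (∣p∩q∣≤∣p∣ J K)) ⟩
          r (A ∪ G) + (r (A ∩ G) + ∣ J ∣)
            ≡⟨ +-assoc (r (A ∪ G)) _ _ ⟨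
          (r (A ∪ G) + r (A ∩ G)) + ∣ J ∣
            ≤⟨ +-monoˡ-≤ ∣ J ∣ (rk-submod M A G) ⟩
          (r A + r G) + ∣ J ∣
            ≡⟨ arrange (r A) _ _ ⟩
          (r A + ∣ J ∣) + r G ∎
          where
          open ≤-Reasoning
          arrange : ∀ x y z → (x + y) + z ≡ (x + z) + y
          arrange = solve-∀

        -- A meet outside the cut costs at least δ ≥ k ≥ ∣ J ∩ K ∣.
        rkJoin-submod-cut : ∀ A B (J K : Subset k) →
          rkJoin (A ∪ B) (J ∪ K) + rkJoin (A ∩ B) (J ∩ K) ≤ minRk A + minRk B
        rkJoin-submod-cut A B J K with minFlat A | minFlat B
        ... | G , (G∈ , A⊆G) , _ | H , (H∈ , B⊆H) , _ with 𝓜 (G ∩ H) in eq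
        ... | true = begin
          rkJoin (A ∪ B) (J ∪ K) + rkJoin (A ∩ B) (J ∩ K)
            ≤⟨ +-mono-≤ (m⊓n≤n (r (A ∪ B) + ∣ J ∪ K ∣) _) (m⊓n≤n (r (A ∩ B) + ∣ J ∩ K ∣) _) ⟩
          minRk (A ∪ B) + minRk (A ∩ B)
            ≤⟨ +-mono-≤
                 (≤-trans (minRk-mono (∪-mono A⊆G B⊆H)) (minRk≤rk G∈ (p⊆p∪q H)))
                 (minRk-≤ eq (∩-mono A⊆G B⊆H)) ⟩
          r (G ∪ H) + r (G ∩ H)
            ≤⟨ rk-submod M G H ⟩
          r G + r H ∎
          where open ≤-Reasoning
        ... | false = begin
          rkJoin (A ∪ B) (J ∪ K) + rkJoin (A ∩ B) (J ∩ K)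
            ≤⟨ +-mono-≤ (m⊓n≤n (r (A ∪ B) + ∣ J ∪ K ∣) _) (m⊓n≤m _ _) ⟩
          minRk (A ∪ B) + (r (A ∩ B) + ∣ J ∩ K ∣)
            ≤⟨ +-mono-≤
                 (≤-trans (minRk-mono (∪-mono A⊆G B⊆H)) (minRk≤rk G∈ (p⊆p∪q H)))
                 (+-mono-≤ (rk-mono M (∩-mono A⊆G B⊆H))
                   (≤-trans (∣p∣≤n (J ∩ K)) (k≤δ G H (G∈ , H∈ , eq)))) ⟩
          r (G ∪ H) + (r (G ∩ H) + δ G H)
            ≡⟨ arrange (r (G ∪ H)) (r (G ∩ H)) (δ G H) ⟩
          δ G H + (r (G ∪ H) + r (G ∩ H))
            ≡⟨ δ-spec G H ⟩
          r G + r H ∎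
          where
          open ≤-Reasoning
          arrange : ∀ x y z → x + (y + z) ≡ z + (x + y)
          arrange = solve-∀

      -- The cases record which term attains each minimum on the right. Two free terms reduce to
      -- submodularity of `r` and modularity of cardinality.
      rkJoin-submod : ∀ A B (J K : Subset k) →
        rkJoin (A ∪ B) (J ∪ K) + rkJoin (A ∩ B) (J ∩ K) ≤ rkJoin A J + rkJoin B K
      rkJoin-submod A B J K with ⊓-sel (r A + ∣ J ∣) (minRk A) | ⊓-sel (r B + ∣ K ∣) (minRk B)
      ... | inj₁ eqA | inj₁ eqB = begin
        rkJoin (A ∪ B) (J ∪ K) + rkJoin (A ∩ B) (J ∩ K)
          ≤⟨ +-mono-≤ (m⊓n≤m (r (A ∪ B) + ∣ J ∪ K ∣) _) (m⊓n≤m (r (A ∩ B) + ∣ J ∩ K ∣) _) ⟩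
        (r (A ∪ B) + ∣ J ∪ K ∣) + (r (A ∩ B) + ∣ J ∩ K ∣)
          ≡⟨ arrange (r (A ∪ B)) _ _ _ ⟩
        (r (A ∪ B) + r (A ∩ B)) + (∣ J ∪ K ∣ + ∣ J ∩ K ∣)
          ≤⟨ +-mono-≤ (rk-submod M A B) (≤-reflexive (∣p∪q∣+∣p∩q∣≡∣p∣+∣q∣ J K)) ⟩
        (r A + r B) + (∣ J ∣ + ∣ K ∣)
          ≡⟨ arrange (r A) _ _ _ ⟩
        (r A + ∣ J ∣) + (r B + ∣ K ∣)
          ≡⟨ cong₂ _+_ eqA eqB ⟨
        rkJoin A J + rkJoin B K ∎
        where
        open ≤-Reasoning
        arrange : ∀ x y z w → (x + y) + (z + w) ≡ (x + z) + (y + w)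
        arrange = solve-∀
      ... | inj₁ eqA | inj₂ eqB =
        ≤-trans (rkJoin-submod-mixed A B J K) (≤-reflexive (sym (cong₂ _+_ eqA eqB)))
      ... | inj₂ eqA | inj₁ eqB = begin
        rkJoin (A ∪ B) (J ∪ K) + rkJoin (A ∩ B) (J ∩ K)
          ≡⟨ cong₂ _+_ (cong₂ rkJoin (∪-comm A B) (∪-comm J K))
                       (cong₂ rkJoin (∩-comm A B) (∩-comm J K)) ⟩
        rkJoin (B ∪ A) (K ∪ J) + rkJoin (B ∩ A) (K ∩ J)
          ≤⟨ rkJoin-submod-mixed B A K J ⟩
        (r B + ∣ K ∣) + minRk A
          ≡⟨ +-comm _ (minRk A) ⟩
        minRk A + (r B + ∣ K ∣)
          ≡⟨ cong₂ _+_ eqA eqB ⟨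
        rkJoin A J + rkJoin B K ∎
        where open ≤-Reasoning
      ... | inj₂ eqA | inj₂ eqB =
        ≤-trans (rkJoin-submod-cut A B J K) (≤-reflexive (sym (cong₂ _+_ eqA eqB)))

      extension : Matroid (n + k)
      rk extension Z = rkJoin (take n Z) (drop n Z)
      rk-bound extension Z = begin
        rkJoin (take n Z) (drop n Z)     ≤⟨ m⊓n≤m _ _ ⟩
        r (take n Z) + ∣ drop n Z ∣      ≤⟨ +-monoˡ-≤ _ (rk-bound M (take n Z)) ⟩
        ∣ take n Z ∣ + ∣ drop n Z ∣      ≡⟨ ∣p++q∣≡∣p∣+∣q∣ (take n Z) (drop n Z) ⟨
        ∣ take n Z ++ drop n Z ∣         ≡⟨ cong ∣_∣ (take++drop≡id n Z) ⟩
        ∣ Z ∣                            ∎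
        where open ≤-Reasoning
      rk-mono extension Z⊆Z′ = rkJoin-mono (take-⊆ n Z⊆Z′) (drop-⊆ n Z⊆Z′)
      rk-submod extension Y Z = begin
        rkJoin (take n (Y ∪ Z)) (drop n (Y ∪ Z)) + rkJoin (take n (Y ∩ Z)) (drop n (Y ∩ Z))
          ≡⟨ cong₂ _+_ (cong₂ rkJoin (take-zipWith {m = n} _ Y Z) (drop-zipWith {m = n} _ Y Z))
                       (cong₂ rkJoin (take-zipWith {m = n} _ Y Z) (drop-zipWith {m = n} _ Y Z)) ⟩
        rkJoin (take n Y ∪ take n Z) (drop n Y ∪ drop n Z)
          + rkJoin (take n Y ∩ take n Z) (drop n Y ∩ drop n Z)
          ≤⟨ rkJoin-submod (take n Y) (take n Z) (drop n Y) (drop n Z) ⟩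
        rkJoin (take n Y) (drop n Y) + rkJoin (take n Z) (drop n Z) ∎
        where open ≤-Reasoning

      -- Ranks and closures in the extension.

      rk-++ : ∀ A J → rk extension (A ++ J) ≡ rkJoin A J
      rk-++ A J = cong₂ rkJoin
        (++-injectiveˡ (take n (A ++ J)) A (take++drop≡id n (A ++ J)))
        (++-injectiveʳ (take n (A ++ J)) A (take++drop≡id n (A ++ J)))

      isExtension : IsExtension M extension
      isExtension X = trans (rk-++ X ⊥) (rkJoin-⊥ X)

      -- A new element adds no rank to a member, while an old element outside `F` still raises the
      -- rank because `F` is a flat of `M`.
      cl-inCut : ∀ {F} → 𝓜 F ≡ true → cl extension (liftSet k F) ≡ F ++ ⊤
      cl-inCut {F} F∈ = trans (tabulate-cong pointwise) (tabulate∘lookup (F ++ ⊤))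
        where
        rk-insert : Fin (n + k) → ℕ
        rk-insert e = rk extension (liftSet k F ∪ ⁅ e ⁆)

        rk-insert-old : ∀ i → rk-insert (i ↑ˡ k) ≡ r (F ∪ ⁅ i ⁆)
        rk-insert-old i = trans
          (cong (rk extension) (trans (cong (liftSet k F ∪_) (⁅↑ˡ⁆ k i))
            (trans (zipWith-++ _ F ⊥ ⁅ i ⁆ ⊥) (cong ((F ∪ ⁅ i ⁆) ++_) (∪-idem ⊥)))))
          (isExtension (F ∪ ⁅ i ⁆))

        rk-insert-new : ∀ j → rk-insert (n ↑ʳ j) ≡ r F
        rk-insert-new j = trans
          (cong (rk extension) (trans (cong (liftSet k F ∪_) (⁅↑ʳ⁆ n j))
            (trans (zipWith-++ _ F ⊥ ⊥ ⁅ j ⁆) (cong₂ _++_ (∪-identityʳ F) (∪-identityˡ ⁅ j ⁆)))))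
          (trans (rk-++ F ⁅ j ⁆) (rkJoin-inCut ⁅ j ⁆ F∈ (λ x → x)))

        pointwise : ∀ e → does (rk-insert e ≟ rk extension (liftSet k F)) ≡ lookup (F ++ ⊤) e
        pointwise e with splitAt n e in eq
        ... | inj₁ i rewrite sym (splitAt⁻¹-↑ˡ {n} eq) | lookup-++ˡ F (⊤ {k}) i with i ∈? F
        ...   | yes i∈F = trans (dec-true (_ ≟ _) (trans (rk-insert-old i)
                  (trans (cong r (∪-absorb i∈F)) (sym (isExtension F))))) (sym ([]=⇒lookup i∈F))
        ...   | no i∉F = trans (dec-false (_ ≟ _) λ same → <⇒≢ (flat F∈ i i∉F)
                  (sym (trans (sym (rk-insert-old i)) (trans same (isExtension F)))))
                  (sym (Bool.¬-not λ i∈F → i∉F (lookup⇒[]= i F i∈F)))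
        pointwise e | inj₂ j rewrite sym (splitAt⁻¹-↑ʳ {n} eq) | lookup-++ʳ F (⊤ {k}) j =
          trans (dec-true (_ ≟ _) (trans (rk-insert-new j) (sym (isExtension F))))
            (sym (lookup-replicate j true))

      -- Bounding `r D` by `r (C ∪ D)` turns the defect bound `k ≤ δ C D` into a gap of at least `k`
      -- between the meet and `C`.
      badPair-gap : ∀ {C D X} → BadPair 𝓜 (C , D) → X ⊆ C ∩ D → r X + k ≤ r C
      badPair-gap {C} {D} {X} bad X⊆ = +-cancelʳ-≤ (r D) _ _ (begin
        (r X + k) + r D                  ≤⟨ +-mono-≤ (+-mono-≤ (rk-mono M X⊆) (k≤δ C D bad))
                                                     (rk-mono M (q⊆p∪q C D)) ⟩
        (r (C ∩ D) + δ C D) + r (C ∪ D)  ≡⟨ arrange (r (C ∩ D)) (δ C D) _ ⟩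
        δ C D + (r (C ∪ D) + r (C ∩ D))  ≡⟨ δ-spec C D ⟩
        r C + r D                        ∎)
        where
        open ≤-Reasoning
        arrange : ∀ x y z → (x + y) + z ≡ y + (z + x)
        arrange = solve-∀

      -- This makes the free term win the minimum at `F ∩ H`, so all `k` new elements count there.
      -- For a cheapest member `G` above `F ∩ H`, either `(G , F)` is bad, or `G ∩ F` is a member
      -- and `(G ∩ F , H)` is bad with the same meet `F ∩ H`. In both cases `badPair-gap` applies.
      minRk-meet : ∀ {F H} → BadPair 𝓜 (F , H) → r (F ∩ H) + k ≤ minRk (F ∩ H)
      minRk-meet {F} {H} (F∈ , H∈ , F∩H∉) with minFlat (F ∩ H)
      ... | G , (G∈ , FH⊆G) , _ with 𝓜 (G ∩ F) in eq
      ... | false = badPair-gap (G∈ , F∈ , eq) (∩-glb FH⊆G (p∩q⊆p F H))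
      ... | true = ≤-trans
        (badPair-gap (eq , H∈ , subst (λ X → 𝓜 X ≡ false) meet≡ F∩H∉) (⊆-reflexive meet≡))
        (rk-mono M (p∩q⊆p G F))
        where
        meet≡ : F ∩ H ≡ (G ∩ F) ∩ H
        meet≡ = ⊆-antisym (∩-glb (∩-glb FH⊆G (p∩q⊆p F H)) (p∩q⊆q F H))
                          (∩-mono (p∩q⊆q G F) (λ x → x))

      cl-modular : ∀ {F H} → BadPair 𝓜 (F , H) → k ≡ δ F H →
        ModularPair extension (cl extension (liftSet k F)) (cl extension (liftSet k H))
      cl-modular {F} {H} bad@(F∈ , H∈ , _) k≡ rewrite cl-inCut F∈ | cl-inCut H∈ = begin
        rk extension (F ++ ⊤) + rk extension (H ++ ⊤)
          ≡⟨ cong₂ _+_ (trans (rk-++ F ⊤) (rkJoin-inCut ⊤ F∈ (λ x → x)))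
                       (trans (rk-++ H ⊤) (rkJoin-inCut ⊤ H∈ (λ x → x))) ⟩
        r F + r H
          ≡⟨ δ-spec F H ⟨
        δ F H + (r (F ∪ H) + r (F ∩ H))
          ≡⟨ cong (_+ (r (F ∪ H) + r (F ∩ H))) k≡ ⟨
        k + (r (F ∪ H) + r (F ∩ H))
          ≡⟨ arrange k (r (F ∪ H)) (r (F ∩ H)) ⟩
        r (F ∪ H) + (r (F ∩ H) + k)
          -- The union contains the member `F` and gains nothing, so the whole defect is absorbed by
          -- the meet.
          ≡⟨ cong₂ _+_ (rkJoin-inCut (⊤ ∪ ⊤) F∈ (p⊆p∪q H)) rk-meet ⟨
        rkJoin (F ∪ H) (⊤ ∪ ⊤) + rkJoin (F ∩ H) (⊤ ∩ ⊤)
          ≡⟨ cong₂ _+_ (rk-++ (F ∪ H) (⊤ ∪ ⊤)) (rk-++ (F ∩ H) (⊤ ∩ ⊤)) ⟨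
        rk extension ((F ∪ H) ++ (⊤ ∪ ⊤)) + rk extension ((F ∩ H) ++ (⊤ ∩ ⊤))
          ≡⟨ cong₂ _+_ (cong (rk extension) (zipWith-++ _ F ⊤ H ⊤))
                       (cong (rk extension) (zipWith-++ _ F ⊤ H ⊤)) ⟨
        rk extension ((F ++ ⊤) ∪ (H ++ ⊤)) + rk extension ((F ++ ⊤) ∩ (H ++ ⊤)) ∎
        where
        open ≡-Reasoning
        arrange : ∀ x y z → x + (y + z) ≡ y + (z + x)
        arrange = solve-∀
        rk-meet : rkJoin (F ∩ H) (⊤ {k} ∩ ⊤) ≡ r (F ∩ H) + k
        rk-meet = trans
          (cong (λ c → (r (F ∩ H) + c) ⊓ minRk (F ∩ H)) (trans (cong ∣_∣ (∩-idem (⊤ {k}))) (∣⊤∣≡n k)))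
          (m≤n⇒m⊓n≡m (minRk-meet bad))

theorem7 : ∀ {n} (M : Matroid n) → ¬ OTE M →
    Σ (Subset n) λ F → Σ (Subset n) λ H →
    IsFlat M F × IsHyperplane M H × ¬ ModularPair M F H ×
    Σ ℕ λ k → Σ (Matroid (n + k)) λ N →
    IsExtension M N × ModularPair N (cl N (liftSet k F)) (cl N (liftSet k H))
theorem7 M ¬ote with ¬OTE⇒badPair M ¬ote
... | 𝓜 , cut , someBad with badPair⇒hyperplane M 𝓜 cut someBad
... | F , H , bad@(F∈ , _) , hyper , minimal =
  F , H , proj₁ cut F F∈ , hyper , badPair⇒¬modular M 𝓜 cut bad ,
  -- With `δ M F H` new elements, `minimal` is exactly the bound on defects that `FreeExtension`
  -- asks for.
  δ M F H , extension , isExtension , cl-modular bad refl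
  where open FreeExtension M 𝓜 cut (F , F∈) (δ M F H) minimal
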